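{- Let $\mathcal{L}=\langle S, Act_\tau,\to\rangle$ be a finite-branching labelled transition system of processes. Then for every formula $\phi\in\mathrm{mustHML}$ there exists a test $t$ (a closed term of the test language) such that $\phi$ must-represents $t$; that is, for every $p\in S$, $p\ \mathbf{must\ satisfy}\ t$ if and only if $p\in[\![\phi]\!]$.
   Context: **Labelled transition systems.** An LTS over a countable set $Act$ of external actions is a triple $\langle S,Act_\tau,\to\rangle$ with $S$ a countable set of states (processes), $Act_\tau=Act\cup\{\tau\}$ where $\tau\notin Act$, and $\to\subseteq S\times Act_\tau\times S$; write $s\xrightarrow{\alpha}s'$ for $(s,\alpha,s')\in\to$, and $s\xrightarrow{\alpha}$ if such an $s'$ exists. The letter $a$ ranges over $Act$, $\alpha$ over $Act_\tau$. $\mathrm{Succ}(s)=\{s' : s\xrightarrow{\alpha}s'\text{ for some }\alpha\in Act_\tau\}$; the LTS is finite branching if $\mathrm{Succ}(s)$ is finite for all $s\in S$. $s\Uparrow$ (diverges) if there is an infinite path $s\xrightarrow{\tau}s_1\xrightarrow{\tau}\cdots$; otherwise $s\Downarrow$ (converges). Weak transitions: $\stackrel{\tau}{\Rightarrow}$ is the reflexive transitive closure of $\xrightarrow{\tau}$, and $s\stackrel{a}{\Rightarrow}s'$ means $s\stackrel{\tau}{\Rightarrow}s''\xrightarrow{a}s'''\stackrel{\tau}{\Rightarrow}s'$ for some $s'',s'''$; $s\stackrel{\alpha}{\Rightarrow}$ means $s\stackrel{\alpha}{\Rightarrow}s'$ for some $s'$. **The language mustHML.** It is the set of closed formulae generated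 by $\phi ::= \mathtt{tt}\mid\mathtt{ff}\mid \mathrm{Acc}\,A\mid X\mid[\alpha]\phi\mid\phi_1\wedge\phi_2\mid \min(X,\phi)$, where $X$ ranges over a countable set $Var$ of variables, $\alpha\in Act_\tau$, $A$ is a finite subset of $Act$, and $\min(X,\cdot)$ binds $X$. Given an environment $\rho:Var\to 2^S$, formulae are interpreted by: $[\![\mathtt{tt}]\!]\rho=S$; $[\![\mathtt{ff}]\!]\rho=\emptyset$; $[\![X]\!]\rho=\rho(X)$; $[\![\mathrm{Acc}\,A]\!]\rho=\{s : s\Downarrow,\text{ and } s\stackrel{\tau}{\Rightarrow}s'\text{ implies } s'\stackrel{a}{\Rightarrow}\text{ for some }a\in A\}$; $[\![[\alpha]\phi]\!]\rho=\{s : s\Downarrow,\text{ and } s\stackrel{\alpha}{\Rightarrow}s'\text{ implies }s'\in[\![\phi]\!]\rho\}$; $[\![\phi_1\wedge\phi_2]\!]\rho=[\![\phi_1]\!]\rho\cap[\![\phi_2]\!]\rho$; $[\![\min(X,\phi)]\!]\rho=\bigcap\{P\subseteq S : [\![\phi]\!]\rho[X\mapsto P]\subseteq P\}$. For closed $\phi$ the environment is omitted. **Tests.** Let $\omega\notin Act_\tau$. Tests are the closed terms of $t::=0\mid\alpha.t\mid\omega.0\mid X\mid t_1+t_2\mid\mu X.t$ ($\alpha\in Act_\tau$, $\mu X$ binds $X$), with transitions given by the rules: $\alpha.t\xrightarrow{\alpha}t$ for $\alpha\in Act_\tau\cup\{\omega\}$; if $t_i\xrightarrow{\alpha}t'$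 for $i=1$ or $i=2$ then $t_1+t_2\xrightarrow{\alpha}t'$; $\mu X.t\xrightarrow{\tau}t\{\mu X.t/X\}$. **Testing.** For a process $p$ and test $t$, the experiment $p\,|\,t$ has only $\tau$-moves: $p|t\to p'|t$ if $p\xrightarrow{\tau}p'$; $p|t\to p|t'$ if $t\xrightarrow{\tau}t'$; $p|t\to p'|t'$ if $p\xrightarrow{a}p'$ and $t\xrightarrow{a}t'$ for some $a\in Act$. A computation of $p|t$ is a maximal (finite or infinite) path $p|t\to p_1|t_1\to\cdots$ (with $p_0=p$, $t_0=t$); it is successful if $t_n\xrightarrow{\omega}$ for some $n\ge0$. $p\ \mathbf{must\ satisfy}\ t$ if every computation of $p|t$ is successful. -}

module Defs where

open import Data.Bool.Base using (Bool; T)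
open import Data.Empty using (⊥)
open import Data.Fin.Base using (Fin; zero; suc)
open import Data.List.Base using (List; []; _∷_)
open import Data.List.Membership.Propositional using (_∈_)
open import Data.List.Relation.Unary.Any using (Any)
open import Data.Nat.Base using (ℕ; zero; suc)
open import Data.Product.Base using (Σ-syntax; ∃-syntax; _×_; _,_)
open import Data.Sum.Base using (_⊎_; [_,_]′)
open import Data.Unit.Base using (⊤)
open import Function.Bundles using (_↣_; _⇔_)
open import Level using (0ℓ)
open import Relation.Binary.Construct.Closure.ReflexiveTransitive using (Star)
open import Relation.Binary.PropositionalEquality.Core using (_≡_)
open import Relation.Nullary.Negation.Core using (¬_)
open import Relation.Unary using (Pred; _≐_)

-- Finite and empty sets count as countable.
Countable : Set → Set
Countable A = A ↣ ℕ

infix 8 ′_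

data Actτ (Act : Set) : Set where
  ′_ : Act → Actτ Act
  τ  : Actτ Act

record LTS (Act : Set) : Set₁ where
  field
    State     : Set
    countable : Countable State
    _—[_]→_   : State → Actτ Act → State → Set

  infix 4 _⇑ _⇓ _—[_]→_ _—τ→_ _=τ⇒_ _=[_]⇒_

  Succ : State → Pred State 0ℓ
  Succ s s′ = ∃[ α ] s —[ α ]→ s′

  _—τ→_ : State → State → Set
  s —τ→ s′ = s —[ τ ]→ s′

  _⇑ : Pred State 0ℓ
  s ⇑ = Σ[ path ∈ (ℕ → State) ] path 0 ≡ s × (∀ n → path n —τ→ path (suc n))

  _⇓ : Pred State 0ℓ
  s ⇓ = ¬ (s ⇑)

  _=τ⇒_ : State → State → Set
  _=τ⇒_ = Star _—τ→_

  _=[_]⇒_ : State → Actτ Act → State → Set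
  s =[ τ   ]⇒ s′ = s =τ⇒ s′
  s =[ ′ a ]⇒ s′ = ∃[ u ] ∃[ v ] s =τ⇒ u × u —[ ′ a ]→ v × v =τ⇒ s′

FiniteBranching : {Act : Set} → LTS Act → Set
FiniteBranching L = ∀ s → ∃[ xs ] Succ s ≐ (_∈ xs)
  where open LTS L

infixr 7 [_]_
infixr 6 _∧_

-- Formulae with at most n free variables, as de Bruijn indices: min binds
-- index zero of its body.  A finite set of actions is given by any list of
-- its elements.
data Formula (Act : Set) (n : ℕ) : Set where
  tt ff : Formula Act n
  Acc   : List Act → Formula Act n
  var   : Fin n → Formula Act n
  [_]_  : Actτ Act → Formula Act n → Formula Act n
  _∧_   : Formula Act n → Formula Act n → Formula Act n
  min   : Formula Act (suc n) → Formula Act n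

mustHML : Set → Set
mustHML Act = Formula Act 0

module Semantics {Act : Set} (L : LTS Act) where
  open LTS L

  -- The powerset 2^S.  Characteristic functions are used instead of
  -- predicates State → Set so that the intersection interpreting min stays
  -- in Set; under excluded middle every predicate has a characteristic
  -- function, so no subset is lost.
  Subset : Set
  Subset = State → Bool

  Env : ℕ → Set
  Env n = Fin n → Subset

  ∅ᵉ : Env 0
  ∅ᵉ ()

  _,[0↦_] : ∀ {n} → Env n → Subset → Env (suc n)
  (ρ ,[0↦ P ]) zero    = P
  (ρ ,[0↦ P ]) (suc i) = ρ i

  ⟦_⟧ : ∀ {n} → Formula Act n → Env n → Pred State 0ℓ
  ⟦ tt ⟧      ρ s = ⊤
  ⟦ ff ⟧      ρ s = ⊥
  ⟦ Acc A ⟧   ρ s = s ⇓ × (∀ s′ → s =τ⇒ s′ → ∃[ a ] a ∈ A × ∃[ u ] s′ =[ ′ a ]⇒ u)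
  ⟦ var X ⟧   ρ s = T (ρ X s)
  ⟦ [ α ] φ ⟧ ρ s = s ⇓ × (∀ s′ → s =[ α ]⇒ s′ → ⟦ φ ⟧ ρ s′)
  ⟦ φ ∧ ψ ⟧   ρ s = ⟦ φ ⟧ ρ s × ⟦ ψ ⟧ ρ s
  ⟦ min φ ⟧   ρ s = ∀ (P : Subset) → (∀ u → ⟦ φ ⟧ (ρ ,[0↦ P ]) u → T (P u)) → T (P s)

infixr 7 _∙_
infixl 6 _⊕_

-- Test terms with at most n free variables; μ binds index zero of its body.
data Term (Act : Set) (n : ℕ) : Set where
  𝟘   : Term Act n
  _∙_ : Actτ Act → Term Act n → Term Act n
  ω∙𝟘 : Term Act n
  var : Fin n → Term Act n
  _⊕_ : Term Act n → Term Act n → Term Act n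
  μ   : Term Act (suc n) → Term Act n

Test : Set → Set
Test Act = Term Act 0

module _ {Act : Set} where

  liftʳ : ∀ {m n} → (Fin m → Fin n) → Fin (suc m) → Fin (suc n)
  liftʳ r zero    = zero
  liftʳ r (suc i) = suc (r i)

  rename : ∀ {m n} → (Fin m → Fin n) → Term Act m → Term Act n
  rename r 𝟘       = 𝟘
  rename r (α ∙ t) = α ∙ rename r t
  rename r ω∙𝟘     = ω∙𝟘
  rename r (var i) = var (r i)
  rename r (t ⊕ u) = rename r t ⊕ rename r u
  rename r (μ t)   = μ (rename (liftʳ r) t)

  liftˢ : ∀ {m n} → (Fin m → Term Act n) → Fin (suc m) → Term Act (suc n)
  liftˢ σ zero    = var zero
  liftˢ σ (suc i) = rename suc (σ i)

  subst : ∀ {m n} → (Fin m → Term Act n) → Term Act m → Term Act n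
  subst σ 𝟘       = 𝟘
  subst σ (α ∙ t) = α ∙ subst σ t
  subst σ ω∙𝟘     = ω∙𝟘
  subst σ (var i) = σ i
  subst σ (t ⊕ u) = subst σ t ⊕ subst σ u
  subst σ (μ t)   = μ (subst (liftˢ σ) t)

  instantiate : ∀ {n} → Term Act n → Fin (suc n) → Term Act n
  instantiate u zero    = u
  instantiate u (suc i) = var i

  _[0≔_] : ∀ {n} → Term Act (suc n) → Term Act n → Term Act n
  t [0≔ u ] = subst (instantiate u) t

data Label (Act : Set) : Set where
  act : Actτ Act → Label Act
  ω   : Label Act

infix 4 _—⟨_⟩→_

data _—⟨_⟩→_ {Act : Set} : Test Act → Label Act → Test Act → Set where
  prefix : ∀ {α t} → α ∙ t —⟨ act α ⟩→ t
  report : ω∙𝟘 —⟨ ω ⟩→ 𝟘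
  sumˡ   : ∀ {ℓ t u t′} → t —⟨ ℓ ⟩→ t′ → t ⊕ u —⟨ ℓ ⟩→ t′
  sumʳ   : ∀ {ℓ t u u′} → u —⟨ ℓ ⟩→ u′ → t ⊕ u —⟨ ℓ ⟩→ u′
  unfold : ∀ {t} → μ t —⟨ act τ ⟩→ t [0≔ μ t ]

module Testing {Act : Set} (L : LTS Act) where
  open LTS L

  infix 4 _⟶_ _must-satisfy_
  infixr 5 _∷_

  -- (p , t) is the experiment p | t.
  Experiment : Set
  Experiment = State × Test Act

  data _⟶_ : Experiment → Experiment → Set where
    process : ∀ {p p′ t} → p —τ→ p′ → (p , t) ⟶ (p′ , t)
    test    : ∀ {p t t′} → t —⟨ act τ ⟩→ t′ → (p , t) ⟶ (p , t′)
    sync    : ∀ {p p′ t t′} (a : Act) → p —[ ′ a ]→ p′ → t —⟨ act (′ a) ⟩→ t′ →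
              (p , t) ⟶ (p′ , t′)

  data FiniteComputation (e : Experiment) : Set where
    halt : (∀ e′ → ¬ (e ⟶ e′)) → FiniteComputation e
    _∷_  : ∀ {e′} → e ⟶ e′ → FiniteComputation e′ → FiniteComputation e

  visited : ∀ {e} → FiniteComputation e → List Experiment
  visited {e} (halt _) = e ∷ []
  visited {e} (_ ∷ c)  = e ∷ visited c

  record InfiniteComputation (e : Experiment) : Set where
    field
      at    : ℕ → Experiment
      start : at 0 ≡ e
      next  : ∀ n → at n ⟶ at (suc n)

  Computation : Experiment → Set
  Computation e = FiniteComputation e ⊎ InfiniteComputation e

  Reports : Pred Experiment 0ℓ
  Reports (p , t) = ∃[ t′ ] t —⟨ ω ⟩→ t′

  Successful : ∀ {e} → Computation e → Set
  Successful = [ (λ c → Any Reports (visited c))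
               , (λ c → ∃[ n ] Reports (InfiniteComputation.at c n)) ]′

  _must-satisfy_ : State → Test Act → Set
  p must-satisfy t = (c : Computation (p , t)) → Successful c

infix 4 _must-represents_within_

_must-represents_within_ : {Act : Set} → mustHML Act → Test Act → LTS Act → Set
φ must-represents t within L = ∀ (p : State) → (p must-satisfy t) ⇔ ⟦ φ ⟧ ∅ᵉ p
  where
  open LTS L
  open Semantics L
  open Testing L

{-# OPTIONS --safe #-}
-- A formula is translated compositionally, min becoming μ.  With "p must
-- satisfy t" read as well-founded induction on the experiment p | t, finite
-- branching bounds the depth of that induction by a natural number, and the
-- bound decreases when μ is unfolded: hence the must-set of μ X. t lies in every
-- prefixed point.  Conversely that must-set is itself a prefixed point.  The
-- catch is that a test which cannot report before a τ-step is failed by every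
-- divergent process, so μ and internal choice only serve for formulae that
-- entail convergence.  These turn out to be all those that are not trivially
-- valid, and the valid ones are represented by ω.
module Submission where

open import Axiom.ExcludedMiddle using (ExcludedMiddle)
open import Data.Bool.Base using (Bool; true; false; T; if_then_else_)
import Data.Bool.Base as Bool
open import Data.Empty using (⊥-elim)
open import Data.Fin.Base using (Fin; zero; suc)
open import Data.List.Base using (List; []; _∷_; _++_; cartesianProduct)
open import Data.List.Membership.Propositional using (_∈_)
open import Data.List.Membership.Propositional.Properties using (∈-++⁺ˡ; ∈-++⁺ʳ; ∈-cartesianProduct⁺)
open import Data.List.Relation.Unary.Any using (Any; here; there)
open import Data.Nat.Base using (ℕ; zero; suc; _≤_; z≤n; s≤s; _⊔_)
open import Data.Nat.Properties using (m≤m⊔n; m≤n⊔m; n≤1+n)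
open import Data.Product.Base using (Σ-syntax; ∃-syntax; _×_; _,_; proj₁; proj₂)
open import Data.Sum.Base using (_⊎_; inj₁; inj₂)
open import Data.Unit.Base using (tt)
open import Function.Base using (_∘_)
open import Function.Bundles using (mk⇔)
open import Level using (0ℓ)
open import Relation.Binary.Construct.Closure.ReflexiveTransitive using (ε; _◅_; _◅◅_)
open import Relation.Binary.PropositionalEquality
  using (_≡_; refl; sym; trans; cong; cong₂) renaming (subst to transport)
open import Relation.Nullary.Decidable using (yes; no; does; decidable-stable)
open import Relation.Nullary.Negation using (¬_; contradiction)
open import Defs

-- Substitution

module _ {Act : Set} where

  rename-rename : ∀ {l m n} {r : Fin l → Fin m} {s : Fin m → Fin n} {q} →
    (∀ i → s (r i) ≡ q i) → (t : Term Act l) → rename s (rename r t) ≡ rename q t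
  rename-rename eq 𝟘       = refl
  rename-rename eq (α ∙ t) = cong (α ∙_) (rename-rename eq t)
  rename-rename eq ω∙𝟘     = refl
  rename-rename eq (var i) = cong var (eq i)
  rename-rename eq (t ⊕ u) = cong₂ _⊕_ (rename-rename eq t) (rename-rename eq u)
  rename-rename eq (μ t)   =
    cong μ (rename-rename (λ { zero → refl ; (suc i) → cong suc (eq i) }) t)

  subst-rename : ∀ {l m n} {r : Fin l → Fin m} {σ : Fin m → Term Act n} {ρ} →
    (∀ i → σ (r i) ≡ ρ i) → (t : Term Act l) → subst σ (rename r t) ≡ subst ρ t
  subst-rename eq 𝟘       = refl
  subst-rename eq (α ∙ t) = cong (α ∙_) (subst-rename eq t)
  subst-rename eq ω∙𝟘     = refl
  subst-rename eq (var i) = eq i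
  subst-rename eq (t ⊕ u) = cong₂ _⊕_ (subst-rename eq t) (subst-rename eq u)
  subst-rename eq (μ t)   =
    cong μ (subst-rename (λ { zero → refl ; (suc i) → cong (rename suc) (eq i) }) t)

  rename-subst : ∀ {l m n} {σ : Fin l → Term Act m} {r : Fin m → Fin n} {ρ} →
    (∀ i → rename r (σ i) ≡ ρ i) → (t : Term Act l) → rename r (subst σ t) ≡ subst ρ t
  rename-subst eq 𝟘       = refl
  rename-subst eq (α ∙ t) = cong (α ∙_) (rename-subst eq t)
  rename-subst eq ω∙𝟘     = refl
  rename-subst eq (var i) = eq i
  rename-subst eq (t ⊕ u) = cong₂ _⊕_ (rename-subst eq t) (rename-subst eq u)
  rename-subst {σ = σ} {r} {ρ} eq (μ t) = cong μ (rename-subst lifted t)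
    where
    lifted : ∀ i → rename (liftʳ {Act} r) (liftˢ σ i) ≡ liftˢ ρ i
    lifted zero    = refl
    lifted (suc i) = trans (rename-rename (λ _ → refl) (σ i))
      (trans (sym (rename-rename (λ _ → refl) (σ i))) (cong (rename suc) (eq i)))

  subst-subst : ∀ {l m n} {σ : Fin l → Term Act m} {θ : Fin m → Term Act n} {ρ} →
    (∀ i → subst θ (σ i) ≡ ρ i) → (t : Term Act l) → subst θ (subst σ t) ≡ subst ρ t
  subst-subst eq 𝟘       = refl
  subst-subst eq (α ∙ t) = cong (α ∙_) (subst-subst eq t)
  subst-subst eq ω∙𝟘     = refl
  subst-subst eq (var i) = eq i
  subst-subst eq (t ⊕ u) = cong₂ _⊕_ (subst-subst eq t) (subst-subst eq u)
  subst-subst {σ = σ} {θ} {ρ} eq (μ t) = cong μ (subst-subst lifted t)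
    where
    lifted : ∀ i → subst (liftˢ θ) (liftˢ σ i) ≡ liftˢ ρ i
    lifted zero    = refl
    lifted (suc i) = trans (subst-rename (λ _ → refl) (σ i))
      (trans (sym (rename-subst (λ _ → refl) (σ i))) (cong (rename suc) (eq i)))

  subst-id : ∀ {n} {σ : Fin n → Term Act n} →
    (∀ i → σ i ≡ var i) → (t : Term Act n) → subst σ t ≡ t
  subst-id eq 𝟘       = refl
  subst-id eq (α ∙ t) = cong (α ∙_) (subst-id eq t)
  subst-id eq ω∙𝟘     = refl
  subst-id eq (var i) = eq i
  subst-id eq (t ⊕ u) = cong₂ _⊕_ (subst-id eq t) (subst-id eq u)
  subst-id eq (μ t)   =
    cong μ (subst-id (λ { zero → refl ; (suc i) → cong (rename suc) (eq i) }) t)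

  infixl 5 _,ˢ_

  _,ˢ_ : ∀ {m n} → (Fin m → Term Act n) → Term Act n → Fin (suc m) → Term Act n
  (σ ,ˢ u) zero    = u
  (σ ,ˢ u) (suc i) = σ i

  -- Matches one unfolding of `μ` with the extended substitution for which the induction hypothesis
  -- on the body of `min` is used.
  subst-liftˢ-[0≔] : ∀ {m n} {σ : Fin m → Term Act n} {u} t →
    subst (liftˢ σ) t [0≔ u ] ≡ subst (σ ,ˢ u) t
  subst-liftˢ-[0≔] {σ = σ} = subst-subst λ
    { zero    → refl
    ; (suc i) → trans (subst-rename (λ _ → refl) (σ i)) (subst-id (λ _ → refl) (σ i)) }

-- Translation

module _ {Act : Set} where

  -- Boxes and `Acc` demand convergence, and `sound` interprets variables by sets of convergent
  -- processes, so none of these counts as valid.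
  valid : ∀ {n} → Formula Act n → Bool
  valid tt        = true
  valid ff        = false
  valid (Acc A)   = false
  valid (var X)   = false
  valid ([ α ] φ) = false
  valid (φ ∧ ψ)   = valid φ Bool.∧ valid ψ
  valid (min φ)   = valid φ

  accept : ∀ {n} → List Act → Term Act n
  accept []      = 𝟘
  accept (a ∷ A) = ′ a ∙ ω∙𝟘 ⊕ accept A

  -- ⟪ φ ⟫ represents every φ, ⟪ φ ⟫ᶜ only those that are not valid.
  ⟪_⟫ ⟪_⟫ᶜ : ∀ {n} → Formula Act n → Term Act n
  ⟪ φ ⟫ = if valid φ then ω∙𝟘 else ⟪ φ ⟫ᶜ

  ⟪ tt ⟫ᶜ        = ω∙𝟘
  ⟪ ff ⟫ᶜ        = 𝟘
  ⟪ Acc A ⟫ᶜ     = accept A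
  ⟪ var X ⟫ᶜ     = var X
  -- The second summand lets a process that never engages in `a` pass, yet only after a step of the
  -- test, so that divergence still fails.
  ⟪ [ ′ a ] φ ⟫ᶜ = ′ a ∙ ⟪ φ ⟫ ⊕ τ ∙ ω∙𝟘
  ⟪ [ τ ] φ ⟫ᶜ   = τ ∙ ⟪ φ ⟫
  -- Internal choice: the process has to pass whichever branch is taken.
  ⟪ φ ∧ ψ ⟫ᶜ     = τ ∙ ⟪ φ ⟫ ⊕ τ ∙ ⟪ ψ ⟫
  ⟪ min φ ⟫ᶜ     = μ ⟪ φ ⟫

  accept-∈ : ∀ {n} {σ : Fin n → Test Act} {A a} →
    a ∈ A → subst σ (accept A) —⟨ act (′ a) ⟩→ ω∙𝟘
  accept-∈ (here refl) = sumˡ prefix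
  accept-∈ (there a∈A) = sumʳ (accept-∈ a∈A)

  accept-act : ∀ {n} {σ : Fin n → Test Act} A {α t} →
    subst σ (accept A) —⟨ act α ⟩→ t → ∃[ a ] a ∈ A × α ≡ ′ a × t ≡ ω∙𝟘
  accept-act (a ∷ A) (sumˡ prefix) = a , here refl , refl , refl
  accept-act (a ∷ A) (sumʳ step) with accept-act A step
  ... | b , b∈A , α≡b , t≡ω = b , there b∈A , α≡b , t≡ω

  accept-silent : ∀ {n} {σ : Fin n → Test Act} A {t} → ¬ subst σ (accept A) —⟨ ω ⟩→ t
  accept-silent (a ∷ A) (sumʳ step) = accept-silent A step

  successors : Test Act → List (Test Act)
  successors 𝟘       = []
  successors (α ∙ t) = t ∷ []
  successors ω∙𝟘     = 𝟘 ∷ []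
  successors (t ⊕ u) = successors t ++ successors u
  successors (μ t)   = t [0≔ μ t ] ∷ []

  ∈-successors : ∀ {t ℓ t′} → t —⟨ ℓ ⟩→ t′ → t′ ∈ successors t
  ∈-successors prefix = here refl
  ∈-successors report = here refl
  ∈-successors (sumˡ step) = ∈-++⁺ˡ (∈-successors step)
  ∈-successors (sumʳ {t = t} step) = ∈-++⁺ʳ (successors t) (∈-successors step)
  ∈-successors unfold = here refl

-- Uniform bounds and infinite paths

uniform-bound : {A : Set} {B : ℕ → A → Set} → (∀ {m n x} → m ≤ n → B m x → B n x) →
  (∀ x → ∃[ n ] B n x) → ∀ xs → ∃[ n ] (∀ {x} → x ∈ xs → B n x)
uniform-bound mono bound [] = 0 , λ ()
uniform-bound mono bound (x ∷ xs) with bound x | uniform-bound mono bound xs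
... | m , Bx | n , Bxs = m ⊔ n , λ
  { (here refl)  → mono (m≤m⊔n m n) Bx
  ; (there y∈xs) → mono (m≤n⊔m m n) (Bxs y∈xs) }

-- `next` already computes its witness, so iterating it suffices and no choice axiom enters.
dependent-choice : {A : Set} {R : A → A → Set} {P : A → Set} →
  (∀ {x} → P x → ∃[ y ] R x y × P y) → ∀ {x} → P x →
  Σ[ path ∈ (ℕ → A) ] path 0 ≡ x × (∀ n → R (path n) (path (suc n))) × (∀ n → P (path n))
dependent-choice {A} {R} {P} next {x} Px =
  proj₁ ∘ seq , refl , (λ n → proj₁ (proj₂ (next (proj₂ (seq n))))) , proj₂ ∘ seq
  where
  seq : ℕ → Σ[ y ∈ A ] P y
  seq zero    = x , Px
  seq (suc n) = let y , _ , Py = next (proj₂ (seq n)) in y , Py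

module Representation
  (em : ExcludedMiddle 0ℓ) {Act : Set} (L : LTS Act) (finite : FiniteBranching L) where

  open LTS L
  open Semantics L
  open Testing L

  by-contradiction : {P : Set} → ¬ ¬ P → P
  by-contradiction = decidable-stable em

  -- Allows the quantifier over `Subset` in `min` to be instantiated with semantic sets, such as the
  -- must-set of a test.
  characteristic : (State → Set) → Subset
  characteristic P s = does (em {P s})

  characteristic⁺ : ∀ {P s} → P s → T (characteristic P s)
  characteristic⁺ {P} {s} Ps with em {P s}
  ... | yes _  = _
  ... | no ¬Ps = ⊥-elim (¬Ps Ps)

  characteristic⁻ : ∀ {P s} → T (characteristic P s) → P s
  characteristic⁻ {P} {s} h with em {P s}
  ... | yes Ps = Ps

  -- Must testing as an inductive predicate

  -- Demanding a successor makes a silent deadlock fail, where the condition on all successors would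
  -- hold vacuously.
  MustWithin : ℕ → Experiment → Set
  MustWithin zero    e = Reports e
  MustWithin (suc n) e =
    Reports e ⊎ ((∃[ e′ ] e ⟶ e′) × (∀ {e′} → e ⟶ e′ → MustWithin n e′))

  Must : Experiment → Set
  Must e = ∃[ n ] MustWithin n e

  reports⇒must : ∀ n {e} → Reports e → MustWithin n e
  reports⇒must zero    r = r
  reports⇒must (suc n) r = inj₁ r

  must-mono : ∀ {m n e} → m ≤ n → MustWithin m e → MustWithin n e
  must-mono {n = n} z≤n r                       = reports⇒must n r
  must-mono (s≤s m≤n) (inj₁ r)                  = inj₁ r
  must-mono (s≤s m≤n) (inj₂ (can-step , steps)) =
    inj₂ (can-step , must-mono m≤n ∘ steps)

  must-step : ∀ n {e e′} → ¬ Reports e → e ⟶ e′ → MustWithin n e → MustWithin n e′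
  must-step zero    silent step r                  = contradiction r silent
  must-step (suc n) silent step (inj₁ r)           = contradiction r silent
  must-step (suc n) silent step (inj₂ (_ , steps)) = must-mono (n≤1+n n) (steps step)

  -- Reports depend on the test alone, which a move of the process leaves in place; hence, unlike in
  -- `must-step`, an available report is no obstacle.
  must-—τ→ : ∀ n {p p′ t} → p —τ→ p′ → MustWithin n (p , t) → MustWithin n (p′ , t)
  must-—τ→ zero    step r                  = r
  must-—τ→ (suc n) step (inj₁ r)           = inj₁ r
  must-—τ→ (suc n) step (inj₂ (_ , steps)) = must-mono (n≤1+n n) (steps (process step))

  must-=τ⇒ : ∀ n {p p′ t} → p =τ⇒ p′ → MustWithin n (p , t) → MustWithin n (p′ , t)
  must-=τ⇒ n ε              m = m
  must-=τ⇒ n (step ◅ steps) m = must-=τ⇒ n steps (must-—τ→ n step m)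

  -- Along a divergence the test can stay idle; each τ-step spends one unit of the bound, which ends
  -- at a report that a silent test cannot make.
  must⇒⇓ : ∀ n {p t} → (∀ {t′} → ¬ t —⟨ ω ⟩→ t′) → MustWithin n (p , t) → p ⇓
  must⇒⇓ zero    silent (_ , r)        _ = silent r
  must⇒⇓ (suc n) silent (inj₁ (_ , r)) _ = silent r
  must⇒⇓ (suc n) silent (inj₂ (_ , steps)) (path , refl , next) =
    must⇒⇓ n silent (steps (process (next 0))) (path ∘ suc , refl , next ∘ suc)

  step-bounded : ∀ e → ∃[ es ] (∀ {e′} → e ⟶ e′ → e′ ∈ es)
  step-bounded (p , t) with finite p
  ... | ps , succ⊆ps , _ = cartesianProduct (p ∷ ps) (t ∷ successors t) , λ
    { (process p→)      → ∈-cartesianProduct⁺ (there (succ⊆ps (_ , p→))) (here refl)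
    ; (test t→)         → ∈-cartesianProduct⁺ {xs = p ∷ ps} (here refl) (there (∈-successors t→))
    ; (sync a p→ t→)    → ∈-cartesianProduct⁺ (there (succ⊆ps (_ , p→))) (there (∈-successors t→)) }

  -- Each successor brings its own bound; finite branching leaves only finitely many of them, so
  -- they have a maximum.
  must-later : ∀ {e} → (∃[ e′ ] e ⟶ e′) → (∀ {e′} → e ⟶ e′ → Must e′) → Must e
  must-later {e} can-step steps =
    let es , bounded = step-bounded e
        n , within   = uniform-bound {B = λ n e′ → e ⟶ e′ → MustWithin n e′}
                         (λ m≤n m step → must-mono m≤n (m step)) bound es
    in suc n , inj₂ (can-step , λ step → within (bounded step) step)
    where
    bound : ∀ e′ → ∃[ n ] (e ⟶ e′ → MustWithin n e′)
    bound e′ with em {e ⟶ e′}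
    ... | yes step = let n , m = steps step in n , λ _ → m
    -- The list may contain experiments that are not successors; for these any bound holds
    -- vacuously.
    ... | no ¬step = 0 , λ step → contradiction step ¬step

  ¬must-step : ∀ {e} → ¬ Must e → (∃[ e′ ] e ⟶ e′) → ∃[ e′ ] e ⟶ e′ × ¬ Must e′
  ¬must-step ¬m can-step = by-contradiction λ none →
    ¬m (must-later can-step λ step → by-contradiction λ ¬m′ → none (_ , step , ¬m′))

  FailsFinitely : Experiment → Set
  FailsFinitely e = Σ[ c ∈ FiniteComputation e ] ¬ Any Reports (visited c)

  -- Unless some finite computation fails, an experiment outside `Must` can always step to another
  -- one outside it, and these steps form an infinite computation without reports.
  must-satisfy⇒Must : ∀ {p t} → p must-satisfy t → Must (p , t)
  must-satisfy⇒Must {p} {t} must with em {FailsFinitely (p , t)}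
  ... | yes (c , fails) = contradiction (must (inj₁ c)) fails
  ... | no ¬finitely    = by-contradiction λ ¬m →
    let at , start , next , doomed = dependent-choice advance (¬m , ¬finitely)
        n , r = must (inj₂ (record { at = at ; start = start ; next = next }))
    in proj₁ (doomed n) (0 , r)
    where
    Doomed : Experiment → Set
    Doomed e = ¬ Must e × ¬ FailsFinitely e

    advance : ∀ {e} → Doomed e → ∃[ e′ ] e ⟶ e′ × Doomed e′
    advance {e} (¬m , ¬finitely) with em {∃[ e′ ] e ⟶ e′}
    ... | no stuck = contradiction
      (halt (λ e′ step → stuck (e′ , step)) , λ { (here r) → ¬m (0 , r) }) ¬finitely
    ... | yes can-step with ¬must-step ¬m can-step
    ...   | e′ , step , ¬m′ = e′ , step , ¬m′ , λ (c , fails) →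
      ¬finitely (step ∷ c , λ { (here r) → ¬m (0 , r) ; (there rs) → fails rs })

  must-finite : ∀ n {e} → MustWithin n e → (c : FiniteComputation e) → Any Reports (visited c)
  must-finite zero    r        (halt _) = here r
  must-finite zero    r        (_ ∷ _)  = here r
  must-finite (suc n) (inj₁ r) (halt _) = here r
  must-finite (suc n) (inj₁ r) (_ ∷ _)  = here r
  must-finite (suc n) (inj₂ ((e′ , step) , _)) (halt stuck) = contradiction step (stuck e′)
  must-finite (suc n) (inj₂ (_ , steps)) (step ∷ c) = there (must-finite n (steps step) c)

  must-infinite : ∀ n (at : ℕ → Experiment) → (∀ k → at k ⟶ at (suc k)) →
    MustWithin n (at 0) → ∃[ k ] Reports (at k)
  must-infinite zero    at next r        = 0 , r
  must-infinite (suc n) at next (inj₁ r) = 0 , r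
  must-infinite (suc n) at next (inj₂ (_ , steps)) =
    let k , r = must-infinite n (at ∘ suc) (next ∘ suc) (steps (next 0)) in suc k , r

  Must⇒must-satisfy : ∀ {p t} → Must (p , t) → p must-satisfy t
  Must⇒must-satisfy (n , m) (inj₁ c) = must-finite n m c
  Must⇒must-satisfy (n , m) (inj₂ record { at = at ; start = refl ; next = next }) =
    must-infinite n at next m

  must-ω : ∀ {p} → Must (p , ω∙𝟘)
  must-ω = 0 , 𝟘 , report

  -- A failing computation can only avoid the test's own moves by following
  -- τ-steps of the process forever.
  must-resolve : ∀ {p t} → p ⇓ →
    (∀ {q} → p =τ⇒ q → ∃[ e ] (q , t) ⟶ e) →
    (∀ {q t′} → p =τ⇒ q → t —⟨ act τ ⟩→ t′ → Must (q , t′)) →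
    (∀ {q a q′ t′} → p =τ⇒ q → q —[ ′ a ]→ q′ → t —⟨ act (′ a) ⟩→ t′ → Must (q′ , t′)) →
    Must (p , t)
  must-resolve {p} {t} p⇓ can-step tests syncs = by-contradiction λ ¬m →
    let path , start , next , _ = dependent-choice diverge (ε , ¬m) in p⇓ (path , start , next)
    where
    diverge : ∀ {q} → p =τ⇒ q × ¬ Must (q , t) →
      ∃[ q′ ] q —τ→ q′ × p =τ⇒ q′ × ¬ Must (q′ , t)
    diverge (p⇒q , ¬m) with ¬must-step ¬m (can-step p⇒q)
    ... | _ , process q→q′     , ¬m′ = _ , q→q′ , p⇒q ◅◅ (q→q′ ◅ ε) , ¬m′
    ... | _ , test t→t′        , ¬m′ = contradiction (tests p⇒q t→t′) ¬m′
    ... | _ , sync a q→q′ t→t′ , ¬m′ = contradiction (syncs p⇒q q→q′ t→t′) ¬m′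

  -- Validity and convergence

  valid-sound : ∀ {n} (φ : Formula Act n) {ρ p} → valid φ ≡ true → ⟦ φ ⟧ ρ p
  valid-sound tt      _ = tt
  valid-sound (φ ∧ ψ) v with valid φ in vφ
  ... | true = valid-sound φ vφ , valid-sound ψ v
  -- A body true everywhere forces every prefixed point to be all of `State`.
  valid-sound (min φ) v P prefixed = prefixed _ (valid-sound φ v)

  ¬valid⇒⇓ : ∀ {n} (φ : Formula Act n) {ρ p} → valid φ ≡ false →
    (∀ i {q} → T (ρ i q) → q ⇓) → ⟦ φ ⟧ ρ p → p ⇓
  ¬valid⇒⇓ (Acc A)   _  conv (p⇓ , _) = p⇓
  ¬valid⇒⇓ (var X)   _  conv h        = conv X h
  ¬valid⇒⇓ ([ α ] φ) _  conv (p⇓ , _) = p⇓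
  ¬valid⇒⇓ (φ ∧ ψ)   ¬v conv (hφ , hψ) with valid φ in vφ
  ... | true  = ¬valid⇒⇓ ψ ¬v conv hψ
  ... | false = ¬valid⇒⇓ φ vφ conv hφ
  -- By the induction hypothesis on the body, the convergent processes form a prefixed point.
  ¬valid⇒⇓ (min φ) ¬v conv h = characteristic⁻ {_⇓} (h (characteristic _⇓) λ u hu →
    characteristic⁺ {_⇓} (¬valid⇒⇓ φ ¬v
      (λ { zero → characteristic⁻ {_⇓} ; (suc i) → conv i }) hu))

  -- Correctness of the translation

  -- The environment hypothesis carries convergence so that `¬valid⇒⇓` applies to open formulae, as
  -- `must-resolve` requires.
  sound : ∀ {n} (φ : Formula Act n) {ρ σ p} →
    (∀ i {q} → T (ρ i q) → q ⇓ × Must (q , σ i)) →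
    ⟦ φ ⟧ ρ p → Must (p , subst σ ⟪ φ ⟫)

  soundᶜ : ∀ {n} (φ : Formula Act n) {ρ σ p} → valid φ ≡ false →
    (∀ i {q} → T (ρ i q) → q ⇓ × Must (q , σ i)) →
    ⟦ φ ⟧ ρ p → Must (p , subst σ ⟪ φ ⟫ᶜ)

  sound φ env h with valid φ in v
  ... | true  = must-ω
  ... | false = soundᶜ φ v env h

  soundᶜ (Acc A) {σ = σ} _ env (p⇓ , h) = must-resolve p⇓ can-step
    (λ { _ t→ → case-τ (accept-act A t→) })
    (λ { _ _ t→ → case-act (accept-act A t→) })
    where
    can-step : ∀ {q} → _ =τ⇒ q → ∃[ e ] (q , subst σ (accept A)) ⟶ e
    can-step p⇒q with h _ p⇒q
    -- A weak `a`-transition begins either with a τ-step of the process or with `a` itself, which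
    -- the test matches.
    ... | a , a∈A , _ , _ , _ , q→r ◅ _ , _ , _ = _ , process q→r
    ... | a , a∈A , _ , _ , _ , ε , q→v , _     = _ , sync a q→v (accept-∈ a∈A)
    case-τ : ∀ {q t} → ∃[ a ] a ∈ A × τ ≡ ′ a × t ≡ ω∙𝟘 → Must (q , t)
    case-τ (_ , _ , () , _)
    case-act : ∀ {α q t} → ∃[ a ] a ∈ A × α ≡ ′ a × t ≡ ω∙𝟘 → Must (q , t)
    case-act (_ , _ , _ , refl) = must-ω
  soundᶜ (var X) _ env h = proj₂ (env X h)
  soundᶜ ([ ′ a ] φ) _ env (p⇓ , h) = must-resolve p⇓
    (λ _ → _ , test (sumʳ prefix))
    (λ { _ (sumˡ ()) ; _ (sumʳ prefix) → must-ω })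
    (λ { p⇒q q→q′ (sumˡ prefix) → sound φ env (h _ (_ , _ , p⇒q , q→q′ , ε))
       ; _ _ (sumʳ ()) })
  soundᶜ ([ τ ] φ) _ env (p⇓ , h) = must-resolve p⇓
    (λ _ → _ , test prefix)
    (λ { p⇒q prefix → sound φ env (h _ p⇒q) })
    (λ { _ _ () })
  soundᶜ (φ ∧ ψ) ¬v env (hφ , hψ) =
    must-resolve (¬valid⇒⇓ (φ ∧ ψ) ¬v (λ i → proj₁ ∘ env i) (hφ , hψ))
    (λ _ → _ , test (sumˡ prefix))
    -- The process may reach `q` before the test chooses; must testing, established at `p`, is
    -- inherited by `q`.
    (λ { p⇒q (sumˡ prefix) → let n , m = sound φ env hφ in n , must-=τ⇒ n p⇒q m
       ; p⇒q (sumʳ prefix) → let n , m = sound ψ env hψ in n , must-=τ⇒ n p⇒q m })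
    (λ { _ _ (sumˡ ()) ; _ _ (sumʳ ()) })
  soundᶜ (min φ) {ρ} {σ} ¬v env h =
    characteristic⁻ {Passes} (h (characteristic Passes) λ u → characteristic⁺ {Passes} ∘ prefixed u)
    where
    t = μ (subst (liftˢ σ) ⟪ φ ⟫)
    Passes : State → Set
    Passes q = Must (q , t)
    env′ : ∀ i {q} → T ((ρ ,[0↦ characteristic Passes ]) i q) → q ⇓ × Must (q , (σ ,ˢ t) i)
    -- A `μ` test cannot report at once, so passing it already entails the convergence that the
    -- environment hypothesis asks for.
    env′ zero hq =
      let n , m = characteristic⁻ {Passes} hq in must⇒⇓ n (λ ()) m , n , m
    env′ (suc i) = env i
    prefixed : ∀ u → ⟦ φ ⟧ (ρ ,[0↦ characteristic Passes ]) u → Passes u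
    prefixed u hu = must-resolve (¬valid⇒⇓ φ ¬v (λ i → proj₁ ∘ env′ i) hu)
      (λ _ → _ , test unfold)
      (λ { u⇒q unfold → let n , m = sound φ env′ hu in
           transport (λ t′ → Must (_ , t′)) (sym (subst-liftˢ-[0≔] ⟪ φ ⟫)) (n , must-=τ⇒ n u⇒q m) })
      (λ { _ _ () })

  -- From must testing back to satisfaction

  ¬must-𝟘 : ∀ n {p} → ¬ MustWithin n (p , 𝟘)
  ¬must-𝟘 zero    (_ , ())
  ¬must-𝟘 (suc n) (inj₁ (_ , ()))
  ¬must-𝟘 (suc n) (inj₂ ((_ , process p→) , steps)) = ¬must-𝟘 n (steps (process p→))

  -- Follow the successor that `MustWithin` guarantees: τ-steps of the process use up the bound and
  -- the test cannot report first, so a synchronisation on a member of `A` has to come.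
  must-accept : ∀ {k} {σ : Fin k → Test Act} n A {p} → MustWithin n (p , subst σ (accept A)) →
    ∃[ a ] a ∈ A × ∃[ u ] p =[ ′ a ]⇒ u
  must-accept zero    A (_ , r)        = contradiction r (accept-silent A)
  must-accept (suc n) A (inj₁ (_ , r)) = contradiction r (accept-silent A)
  must-accept (suc n) A (inj₂ ((_ , process p→q) , steps)) with must-accept n A (steps (process p→q))
  ... | a , a∈A , u , v , w , q⇒v , v→w , w⇒u = a , a∈A , u , v , w , p→q ◅ q⇒v , v→w , w⇒u
  must-accept (suc n) A (inj₂ ((_ , test t→) , _)) with accept-act A t→
  ... | _ , _ , () , _
  must-accept (suc n) A (inj₂ ((_ , sync a p→q t→) , _)) with accept-act A t→
  ... | _ , a∈A , refl , _ = a , a∈A , _ , _ , _ , ε , p→q , ε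

  -- The bound n is shared by the hypothesis on the environment, so that in the
  -- min case the variable only has to be interpreted below the current bound.
  complete : ∀ {k} (φ : Formula Act k) n {ρ σ p} →
    (∀ i {q} → MustWithin n (q , σ i) → T (ρ i q)) →
    MustWithin n (p , subst σ ⟪ φ ⟫) → ⟦ φ ⟧ ρ p

  completeᶜ : ∀ {k} (φ : Formula Act k) n {ρ σ p} →
    (∀ i {q} → MustWithin n (q , σ i) → T (ρ i q)) →
    MustWithin n (p , subst σ ⟪ φ ⟫ᶜ) → ⟦ φ ⟧ ρ p

  complete φ n env m with valid φ in v
  ... | true  = valid-sound φ v
  ... | false = completeᶜ φ n env m

  completeᶜ tt      n env m = tt
  completeᶜ ff      n env m = ¬must-𝟘 n m
  completeᶜ (Acc A) n env m =
    must⇒⇓ n (accept-silent A) m , λ _ p⇒q → must-accept n A (must-=τ⇒ n p⇒q m)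
  completeᶜ (var X) n env m = env X m
  completeᶜ ([ ′ a ] φ) n env m =
    must⇒⇓ n (λ { (sumˡ ()) ; (sumʳ ()) }) m ,
    λ { _ (_ , _ , p⇒u , u→v , v⇒q) → complete φ n env
          (must-=τ⇒ n v⇒q (must-step n (λ { (_ , sumˡ ()) ; (_ , sumʳ ()) })
            (sync a u→v (sumˡ prefix)) (must-=τ⇒ n p⇒u m))) }
  completeᶜ ([ τ ] φ) n env m =
    must⇒⇓ n (λ ()) m ,
    λ _ p⇒q → complete φ n env (must-step n (λ ()) (test prefix) (must-=τ⇒ n p⇒q m))
  completeᶜ (φ ∧ ψ) n {p = p} env m =
    complete φ n env (must-step n (silent {p}) (test (sumˡ prefix)) m) ,
    complete ψ n env (must-step n (silent {p}) (test (sumʳ prefix)) m)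
    where
    silent : ∀ {p} {t u : Test Act} → ¬ Reports (p , τ ∙ t ⊕ τ ∙ u)
    silent (_ , sumˡ ())
    silent (_ , sumʳ ())
  completeᶜ (min φ) n {ρ} {σ} env m P prefixed = least n env m
    where
    least : ∀ n → (∀ i {q} → MustWithin n (q , σ i) → T (ρ i q)) →
      ∀ {q} → MustWithin n (q , μ (subst (liftˢ σ) ⟪ φ ⟫)) → T (P q)
    least zero    env (_ , ())
    least (suc n) env (inj₁ (_ , ()))
    -- Unfolding spends one unit, so the body is treated at `n`, where the recursive call to `least`
    -- interprets the new variable by `P`.
    least (suc n) env (inj₂ (_ , steps)) = prefixed _ (complete φ n env′
      (transport (λ t → MustWithin n (_ , t)) (subst-liftˢ-[0≔] ⟪ φ ⟫) (steps (test unfold))))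
      where
      env↓ : ∀ i {q} → MustWithin n (q , σ i) → T (ρ i q)
      env↓ i = env i ∘ must-mono (n≤1+n n)
      env′ : ∀ i {q} → MustWithin n (q , (σ ,ˢ μ (subst (liftˢ σ) ⟪ φ ⟫)) i) → T ((ρ ,[0↦ P ]) i q)
      env′ zero    = least n env↓
      env′ (suc i) = env↓ i

  -- `subst var` leaves the closed test unchanged and gives it the shape in which `sound` and
  -- `complete` are stated.
  represents : (φ : mustHML Act) → φ must-represents (subst var ⟪ φ ⟫) within L
  represents φ p = mk⇔
    (λ must → let n , m = must-satisfy⇒Must must in complete φ n {∅ᵉ} {var} (λ ()) m)
    (λ h → Must⇒must-satisfy (sound φ {∅ᵉ} {var} (λ ()) h))

theorem4p14 : ExcludedMiddle 0ℓ → (Act : Set) → Countable Act → (L : LTS Act) → FiniteBranching L →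
    (φ : mustHML Act) → ∃[ t ] (φ must-represents t within L)
theorem4p14 em Act _ L finite φ = subst var ⟪ φ ⟫ , Representation.represents em L finite φ
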